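{- Let $d\ge 0$ be an integer and let $G$ be a $d$-regular graph that contains no $4$-cycle. Then $\varphi(G)\geq\left\lfloor\frac{d+3}{2}\right\rfloor$. Moreover, if $G$ has a triangle, then $\varphi(G)\geq\left\lfloor\frac{d+4}{2}\right\rfloor$. These lower bounds are sharp for the Petersen graph: the Petersen graph is $3$-regular, contains no $4$-cycle, and its b-chromatic number is $3=\left\lfloor\frac{3+3}{2}\right\rfloor=\left\lfloor\frac{3+4}{2}\right\rfloor$.
   Context: All graphs are finite and simple (undirected, loopless, without multiple edges), with nonempty vertex set. "Contains no $4$-cycle" means that $G$ has no subgraph (not necessarily induced) isomorphic to the cycle $C_4$ of length $4$. A b-coloring of a graph $G$ by $k$ colors is a proper vertex coloring with $k$ colors in which each of the $k$ color classes contains a vertex that is adjacent to at least one vertex in each of the other $k-1$ color classes. The b-chromatic number $\varphi(G)$ is the largest integer $k$ such that $G$ admits a b-coloring by $k$ colors. -}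

module Defs where

open import Data.Empty using (⊥)
open import Data.Fin using (Fin; toℕ; splitAt)
open import Data.Fin.Properties using (all?; _≟_)
open import Data.Fin.Subset using (Subset; ∣_∣)
open import Data.Nat using (ℕ; NonZero; _+_; _≤_)
import Data.Nat as ℕ
open import Data.Nat.DivMod using (_%_)
open import Data.Product using (∃-syntax; Σ-syntax; _×_)
open import Data.Sum using (_⊎_; inj₁; inj₂)
open import Data.Vec using (tabulate)
open import Function.Definitions using (Injective)
open import Level using (0ℓ)
open import Relation.Binary.Core using (Rel)
open import Relation.Binary.Definitions using (Symmetric; Irreflexive; Decidable)
open import Relation.Binary.Construct.Closure.Symmetric using (SymClosure; fwd; bwd; symmetric)
open import Relation.Binary.PropositionalEquality using (_≡_; _≢_; refl)
open import Relation.Nullary using (¬_; yes; no; does; ¬?)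
open import Relation.Nullary.Decidable using (from-yes)

record Graph : Set₁ where
  infix 4 _∼_ _∼?_
  field
    order      : ℕ
    ⦃ nonEmpty ⦄ : NonZero order

  V : Set
  V = Fin order

  field
    _∼_      : Rel V 0ℓ
    ∼-sym    : Symmetric _∼_
    ∼-irrefl : Irreflexive _≡_ _∼_
    _∼?_     : Decidable _∼_

  neighbours : V → Subset order
  neighbours v = tabulate (λ w → does (v ∼? w))

  degree : V → ℕ
  degree v = ∣ neighbours v ∣

open Graph using (V)

Regular : ℕ → Graph → Set
Regular d G = ∀ v → Graph.degree G v ≡ d

-- G has a (not necessarily induced) subgraph isomorphic to H.
Contains : Graph → Graph → Set
Contains G H =
  Σ[ f ∈ (V H → V G) ]
    Injective _≡_ _≡_ f × (∀ {u v} → Graph._∼_ H u v → Graph._∼_ G (f u) (f v))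

module _ (G : Graph) where
  open Graph G using (_∼_)

  Proper : ∀ {k} → (V G → Fin k) → Set
  Proper c = ∀ {u v} → u ∼ v → c u ≢ c v

  -- The colour classes are nonempty because each contains the required v.
  IsBColoring : ∀ {k} → (V G → Fin k) → Set
  IsBColoring {k} c =
    Proper c ×
    (∀ (i : Fin k) → ∃[ v ] c v ≡ i × (∀ (j : Fin k) → j ≢ i → ∃[ w ] v ∼ w × c w ≡ j))

  HasBColoring : ℕ → Set
  HasBColoring k = Σ[ c ∈ (V G → Fin k) ] IsBColoring c

  IsBChromaticNumber : ℕ → Set
  IsBChromaticNumber φ = HasBColoring φ × (∀ k → HasBColoring k → k ≤ φ)

-- The underlying simple graph of a loopless digraph.
module _ {n : ℕ} ⦃ _ : NonZero n ⦄ {R : Rel (Fin n) 0ℓ}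
         (R? : Decidable R) (loopless : ∀ i → ¬ R i i) where

  private
    irrefl : Irreflexive _≡_ (SymClosure R)
    irrefl refl (fwd r) = loopless _ r
    irrefl refl (bwd r) = loopless _ r

    dec : Decidable (SymClosure R)
    dec i j with R? i j | R? j i
    ... | yes r | _     = yes (fwd r)
    ... | no _  | yes r = yes (bwd r)
    ... | no ¬r | no ¬s = no λ { (fwd r) → ¬r r ; (bwd s) → ¬s s }

  underlying : Graph
  underlying = record
    { order = n ; _∼_ = SymClosure R ; ∼-sym = symmetric R ; ∼-irrefl = irrefl ; _∼?_ = dec }

-- Step n s i j : j ≡ i + s (mod n).
Step : ∀ n → ⦃ NonZero n ⦄ → ℕ → Rel (Fin n) 0ℓ
Step n s i j = (toℕ i + s) % n ≡ toℕ j

step? : ∀ n ⦃ _ : NonZero n ⦄ s → Decidable (Step n s)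
step? n s i j = (toℕ i + s) % n ℕ.≟ toℕ j

triangle : Graph
triangle = underlying (step? 3 1) (from-yes (all? λ i → ¬? (step? 3 1 i i)))

C₄ : Graph
C₄ = underlying (step? 4 1) (from-yes (all? λ i → ¬? (step? 4 1 i i)))

-- The vertices 0,…,4 form the outer 5-cycle, the vertices 5,…,9 form the inner
-- pentagram, and the spokes join i to 5 + i.
PetersenArc : Rel (Fin 5 ⊎ Fin 5) 0ℓ
PetersenArc (inj₁ i) (inj₁ j) = Step 5 1 i j
PetersenArc (inj₂ i) (inj₂ j) = Step 5 2 i j
PetersenArc (inj₁ i) (inj₂ j) = i ≡ j
PetersenArc (inj₂ i) (inj₁ j) = ⊥

petersenArc? : Decidable PetersenArc
petersenArc? (inj₁ i) (inj₁ j) = step? 5 1 i j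
petersenArc? (inj₂ i) (inj₂ j) = step? 5 2 i j
petersenArc? (inj₁ i) (inj₂ j) = i ≟ j
petersenArc? (inj₂ i) (inj₁ j) = no λ ()

petersen : Graph
petersen = underlying arc? (from-yes (all? λ i → ¬? (arc? i i)))
  where
  arc? : Decidable (λ (i j : Fin 10) → PetersenArc (splitAt 5 i) (splitAt 5 j))
  arc? i j = petersenArc? (splitAt 5 i) (splitAt 5 j)

{-# OPTIONS --safe #-}
-- Colour with d + 1 colours.  A vertex whose closed neighbourhood receives all of
-- them stays a b-vertex when a class without b-vertices is dissolved, and any partial
-- proper (d + 1)-colouring extends greedily; so it suffices to colour the closed
-- neighbourhoods of a vertex v and of many neighbours x of v bijectively and
-- consistently.  The stars at the x are treated one at a time.  As there is no 4-cycle,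
-- a private neighbour of x has at most one neighbour in each earlier star, and each
-- colour is forbidden at most once per earlier star; so after f stars a bijection
-- with a conflict can be improved by a swap as long as 2f is at most the number of
-- private neighbours.  This gives ⌊(d+1)/2⌋ stars.  If v a b is a triangle, treating a
-- first and b last gains one more star when d is even, since the stars at a and b do
-- not conflict.
module Submission where

open import Defs
open import Data.Fin using (Fin; zero; suc; join; splitAt; punchOut; punchIn; finToFun; funToFin; fromℕ<)
open import Data.Fin.Patterns using (0F; 1F; 2F; 3F; 4F; 5F; 6F; 7F; 8F; 9F)
open import Data.Fin.Permutation using (Permutation′; transpose; _∘ₚ_; _⟨$⟩ʳ_; _⟨$⟩ˡ_; inverseˡ; inverseʳ)
import Data.Fin.Permutation as Perm
import Data.Fin.Permutation.Components as PC
open import Data.Fin.Properties using (_≟_; any?; all?; <⇒notInjective; injective⇒≤; splitAt-join; suc-injective; punchOut-injective; punchOut-cong; punchOut-punchIn; punchInᵢ≢i; finToFun-funToFin)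
open import Data.Fin.Subset using (∣_∣)
open import Data.List using (List; []; _∷_; length; lookup; filter; allFin)
import Data.List.Membership.DecPropositional as DecMembership
open import Data.List.Membership.Propositional using (_∈_; _∉_; find; lose)
open import Data.List.Membership.Propositional.Properties using (∈-allFin; ∈-lookup; ∈-filter⁺; ∈-filter⁻)
open import Data.List.Properties using (length-filter; filter-notAll)
open import Data.List.Relation.Unary.All as All using (All; []; _∷_)
open import Data.List.Relation.Unary.All.Properties using (¬Any⇒All¬)
open import Data.List.Relation.Unary.AllPairs using ([]; _∷_)
open import Data.List.Relation.Unary.Any as Any using (Any; here; there)
open import Data.List.Relation.Unary.Any.Properties using (lookup-index)
open import Data.List.Relation.Unary.Unique.Propositional using (Unique)
open import Data.Nat using (ℕ; zero; suc; _+_; _≤_; _<_; z≤n; s≤s; ⌊_/2⌋; >-nonZero⁻¹)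
import Data.Nat.Properties as ℕ
open import Data.Product using (∃; ∃-syntax; Σ-syntax; _×_; _,_; proj₁; proj₂)
open import Data.Sum using (_⊎_; inj₁; inj₂; map₂)
open import Data.Sum.Properties using (inj₁-injective; inj₂-injective)
open import Data.Unit using (⊤; tt)
open import Data.Vec as Vec using ([]; _∷_; tabulate)
open import Data.Vec.Properties using (lookup∘tabulate)
open import Function using (_∘_)
open import Function.Definitions using (Injective)
open import Relation.Binary.Construct.Closure.Symmetric using (fwd; bwd)
open import Relation.Binary.PropositionalEquality using (_≡_; _≢_; _≗_; refl; sym; trans; cong; subst)
open import Relation.Nullary using (¬_; Dec; yes; no; does; ¬?; contradiction)
open import Relation.Nullary.Decidable using (_×-dec_; _⊎-dec_; _→-dec_; map′; decidable-stable; from-yes; True; toWitness)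
open import Relation.Unary using (Decidable)

private
  variable
    m n r f : ℕ

-- Finite sets: injections, enumeration, bounded search.

join-injective : ∀ m n {x y : Fin m ⊎ Fin n} → join m n x ≡ join m n y → x ≡ y
join-injective m n {x} {y} eq =
  trans (sym (splitAt-join m n x)) (trans (cong (splitAt m) eq) (splitAt-join m n y))

-- A missed value could be punched out, leaving an injection of `Fin (suc n)` into `Fin n`.
injective⇒surjective : {g : Fin n → Fin n} → Injective _≡_ _≡_ g → ∀ j → ∃[ i ] g i ≡ j
injective⇒surjective {suc n} {g} g-inj j with any? (λ i → g i ≟ j)
... | yes hit = hit
... | no miss = contradiction
  (λ {x} {y} → g-inj ∘ punchOut-injective (missed x) (missed y))
  (<⇒notInjective ℕ.≤-refl)
  where
  missed : ∀ i → j ≢ g i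
  missed i eq = miss (i , sym eq)

-- The index type has the size used to define `degree`, so the neighbours of a vertex are listed by
-- exactly as many indices as its degree.
enumerate : {P : Fin n → Set} (P? : Decidable P) →
  Σ[ e ∈ (Fin ∣ tabulate (does ∘ P?) ∣ → Fin n) ]
    Injective _≡_ _≡_ e × (∀ i → P (e i)) × (∀ {w} → P w → ∃[ i ] e i ≡ w)
enumerate {zero} P? = (λ ()) , (λ { {()} }) , (λ ()) , λ { {()} }
enumerate {suc n} {P} P? with P? zero | enumerate (P? ∘ suc)
... | yes p | e , e-inj , e-P , e-onto = e′ , inj , sat , onto
  where
  e′ : Fin (suc _) → Fin (suc n)
  e′ zero    = zero
  e′ (suc i) = suc (e i)
  inj : Injective _≡_ _≡_ e′
  inj {zero}  {zero}  eq = refl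
  inj {zero}  {suc j} ()
  inj {suc i} {zero}  ()
  inj {suc i} {suc j} eq = cong suc (e-inj (suc-injective eq))
  sat : ∀ i → P (e′ i)
  sat zero    = p
  sat (suc i) = e-P i
  onto : ∀ {w} → P w → ∃[ i ] e′ i ≡ w
  onto {zero}  _ = zero , refl
  onto {suc w} q with i , eq ← e-onto q = suc i , cong suc eq
... | no ¬p | e , e-inj , e-P , e-onto = suc ∘ e , e-inj ∘ suc-injective , e-P , onto
  where
  onto : ∀ {w} → P w → ∃[ i ] suc (e i) ≡ w
  onto {zero}  q = contradiction q ¬p
  onto {suc w} q with i , eq ← e-onto q = i , cong suc eq

maximum : {P : ℕ → Set} → Decidable P → ∀ b → (∀ k → P k → k ≤ b) → ∀ {k} → P k →
  ∃[ m ] P m × (∀ k → P k → k ≤ m)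
maximum P? b bound {k} pk with P? b
... | yes pb = b , pb , bound
maximum {P} P? zero    bound {k} pk | no ¬pb = contradiction (subst P (ℕ.n≤0⇒n≡0 (bound k pk)) pk) ¬pb
maximum {P} P? (suc b) bound {k} pk | no ¬pb = maximum P? b bound′ pk
  where
  bound′ : ∀ k → P k → k ≤ b
  bound′ k pk = ℕ.≤-pred (ℕ.≤∧≢⇒< (bound k pk) λ { refl → ¬pb pk })

-- Functions between finite sets are coded by numbers. Decoding a code recovers a function only
-- pointwise, so `Q` has to respect pointwise equality.
∃-function? : {Q : (Fin m → Fin n) → Set} → Decidable Q →
  (∀ {c c′} → c ≗ c′ → Q c → Q c′) → Dec (∃ Q)
∃-function? Q? resp = map′
  (λ (i , q) → finToFun i , q)
  (λ (c , q) → funToFin c , resp (sym ∘ finToFun-funToFin c) q)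
  (any? (Q? ∘ finToFun))

-- Permutations improved by swaps.

transpose-left : (i j : Fin n) → PC.transpose i j i ≡ j
transpose-left i j with i ≟ i
... | yes _ = refl
... | no ¬p = contradiction refl ¬p

transpose-other : {i j k : Fin n} → k ≢ i → k ≢ j → PC.transpose i j k ≡ k
transpose-other {i = i} {j} {k} k≢i k≢j with k ≟ i
... | yes p = contradiction p k≢i
... | no _ with k ≟ j
...   | yes p = contradiction p k≢j
...   | no _ = refl

-- Points are visited one at a time. A swap changes the images of `u` and `w` only: it makes `u`
-- good, and the last clause keeps `w` good if it was, so no earlier success is lost.
repair : (Inv : Permutation′ n → Set) {P : Fin n → Fin n → Set} → (∀ u → Decidable (P u)) →
  (∀ σ → Inv σ → ∀ u → ¬ P u (σ ⟨$⟩ʳ u) →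
    ∃[ w ] Inv (transpose u w ∘ₚ σ) × P u (σ ⟨$⟩ʳ w) × (P w (σ ⟨$⟩ʳ w) → P w (σ ⟨$⟩ʳ u))) →
  ∀ σ → Inv σ → ∃[ τ ] Inv τ × (∀ u → P u (τ ⟨$⟩ʳ u))
repair {n} Inv {P} P? swap σ inv =
  let τ , inv′ , ps = go (allFin n) in τ , inv′ , λ u → All.lookup ps (∈-allFin u)
  where
  go : ∀ us → ∃[ τ ] Inv τ × All (λ u → P u (τ ⟨$⟩ʳ u)) us
  go [] = σ , inv , []
  go (u ∷ us) with go us
  ... | τ , inv′ , ps with P? u (τ ⟨$⟩ʳ u)
  ...   | yes p = τ , inv′ , p ∷ ps
  ...   | no ¬p with w , inv″ , pu , pw ← swap τ inv′ u ¬p =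
    transpose u w ∘ₚ τ , inv″ , at-u ∷ All.map (λ {x} → keep x) ps
    where
    at-u : P u (τ ⟨$⟩ʳ (PC.transpose u w u))
    at-u = subst (P u ∘ (τ ⟨$⟩ʳ_)) (sym (transpose-left u w)) pu
    keep : ∀ x → P x (τ ⟨$⟩ʳ x) → P x (τ ⟨$⟩ʳ (PC.transpose u w x))
    keep x px with x ≟ u
    ... | yes refl = pu
    ... | no x≢u with x ≟ w
    ...   | yes refl = pw px
    ...   | no x≢w = px

-- A wrong `u` is swapped with the preimage `w` of `φ u`. If `w` were prescribed and already right,
-- then `φ w` would equal `φ u`, forcing `w` to be `u`, which is wrong.
extend-injection : {F : Fin n → Set} → Decidable F → (φ : Fin n → Fin n) →
  (∀ {u w} → F u → F w → φ u ≡ φ w → u ≡ w) →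
  Σ[ σ ∈ Permutation′ n ] (∀ u → F u → σ ⟨$⟩ʳ u ≡ φ u)
extend-injection {n} {F} F? φ φ-inj =
  let σ , _ , ok = repair (λ _ → ⊤) (λ u c → F? u →-dec (c ≟ φ u)) swap Perm.id tt in σ , ok
  where
  swap : ∀ σ → ⊤ → ∀ u → ¬ (F u → σ ⟨$⟩ʳ u ≡ φ u) → _
  swap σ _ u bad = w , tt , (λ _ → inverseʳ σ) , λ ok Fw →
    let w≡u = φ-inj Fw Fu (trans (sym (ok Fw)) (inverseʳ σ)) in
    contradiction (λ _ → trans (cong (σ ⟨$⟩ʳ_) (sym w≡u)) (inverseʳ σ)) bad
    where
    w = σ ⟨$⟩ˡ φ u
    Fu : F u
    Fu = decidable-stable (F? u) λ ¬Fu → bad λ Fu → contradiction Fu ¬Fu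

-- A König–Hall matching with prescribed part: every bad u has a partner w whose
-- image can be exchanged with that of u, since otherwise the labels would inject
-- n + 1 objects (the w's, and the conflict of u once more) into r + 2f.
avoiding-permutation : {F : Fin n → Set} {B : Fin n → Fin n → Set} →
  Decidable F → (∀ u → Decidable (B u)) →
  (φ : Fin n → Fin n) → (∀ {u w} → F u → F w → φ u ≡ φ w → u ≡ w) →
  (ρ : Fin n → Fin r) → (∀ {u w} → F u → F w → ρ u ≡ ρ w → u ≡ w) →
  (label : ∀ {u c} → B u c → Fin f) →
  (∀ {u c c′} → ¬ F u → (b : B u c) (b′ : B u c′) → label b ≡ label b′ → c ≡ c′) →
  (∀ {u u′ c} → ¬ F u → ¬ F u′ → (b : B u c) (b′ : B u′ c) → label b ≡ label b′ → u ≡ u′) →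
  r + (f + f) ≤ n →
  Σ[ σ ∈ Permutation′ n ]
    (∀ u → F u → σ ⟨$⟩ʳ u ≡ φ u) × (∀ u → ¬ F u → ¬ B u (σ ⟨$⟩ʳ u))
avoiding-permutation {n} {r} {f} {F} {B} F? B? φ φ-inj ρ ρ-inj label label-c label-u small =
  let σ₀ , inv₀ = extend-injection F? φ φ-inj in
  repair Inv (λ u c → ¬? (F? u) →-dec ¬? (B? u c)) swap σ₀ inv₀
  where
  code : Fin r ⊎ (Fin f ⊎ Fin f) → Fin (r + (f + f))
  code = join r (f + f) ∘ map₂ (join f f)

  code-injective : ∀ {x y} → code x ≡ code y → x ≡ y
  code-injective {x} {y} = split x y ∘ join-injective r (f + f)
    where
    split : ∀ x y → map₂ (join f f) x ≡ map₂ (join f f) y → x ≡ y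
    split (inj₁ _) (inj₁ _) refl = refl
    split (inj₂ _) (inj₂ _) eq   = cong inj₂ (join-injective f f (inj₂-injective eq))

  module _ (σ : Permutation′ n) {u} (¬Fu : ¬ F u) (bad : B u (σ ⟨$⟩ʳ u)) where
    σ-injective : ∀ {x y} → σ ⟨$⟩ʳ x ≡ σ ⟨$⟩ʳ y → x ≡ y
    σ-injective eq = trans (sym (inverseˡ σ)) (trans (cong (σ ⟨$⟩ˡ_) eq) (inverseˡ σ))

    Partner Blocked : Fin n → Set
    Partner w = ¬ F w × ¬ B u (σ ⟨$⟩ʳ w) × ¬ B w (σ ⟨$⟩ʳ u)
    Blocked w = F w ⊎ B u (σ ⟨$⟩ʳ w) ⊎ (¬ F w × ¬ B u (σ ⟨$⟩ʳ w) × B w (σ ⟨$⟩ʳ u))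

    partner-or-blocked : ∀ w → Partner w ⊎ Blocked w
    partner-or-blocked w with F? w | B? u (σ ⟨$⟩ʳ w) | B? w (σ ⟨$⟩ʳ u)
    ... | yes Fw | _     | _     = inj₂ (inj₁ Fw)
    ... | no ¬Fw | yes b | _     = inj₂ (inj₂ (inj₁ b))
    ... | no ¬Fw | no ¬b | yes b = inj₂ (inj₂ (inj₂ (¬Fw , ¬b , b)))
    ... | no ¬Fw | no ¬b | no ¬c = inj₁ (¬Fw , ¬b , ¬c)

    tag : ∀ {w} → Blocked w → Fin r ⊎ (Fin f ⊎ Fin f)
    tag {w} (inj₁ _)                  = inj₁ (ρ w)
    tag     (inj₂ (inj₁ b))           = inj₂ (inj₁ (label b))
    tag     (inj₂ (inj₂ (_ , _ , b))) = inj₂ (inj₂ (label b))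

    tag-injective : ∀ {w w′} (p : Blocked w) (p′ : Blocked w′) → tag p ≡ tag p′ → w ≡ w′
    tag-injective (inj₁ _) (inj₂ (inj₁ _)) ()
    tag-injective (inj₁ _) (inj₂ (inj₂ _)) ()
    tag-injective (inj₁ Fw) (inj₁ Fw′) eq = ρ-inj Fw Fw′ (inj₁-injective eq)
    tag-injective (inj₂ (inj₁ b)) (inj₂ (inj₁ b′)) eq =
      σ-injective (label-c ¬Fu b b′ (inj₁-injective (inj₂-injective eq)))
    tag-injective (inj₂ (inj₂ (¬Fw , _ , b))) (inj₂ (inj₂ (¬Fw′ , _ , b′))) eq =
      label-u ¬Fw ¬Fw′ b b′ (inj₂-injective (inj₂-injective eq))

    tag-avoids : ∀ {w} (p : Blocked w) → tag p ≢ inj₂ (inj₂ (label bad))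
    tag-avoids (inj₂ (inj₂ (¬Fw , ¬b , b))) eq
      with refl ← label-u ¬Fw ¬Fu b bad (inj₂-injective (inj₂-injective eq)) = ¬b bad

    not-all-blocked : ¬ (∀ w → Blocked w)
    not-all-blocked blocked = <⇒notInjective (s≤s small) λ {x} {y} eq → h-injective x y (code-injective eq)
      where
      h : Fin (suc n) → Fin r ⊎ (Fin f ⊎ Fin f)
      h zero    = inj₂ (inj₂ (label bad))
      h (suc w) = tag (blocked w)

      h-injective : ∀ x y → h x ≡ h y → x ≡ y
      h-injective zero    zero    eq = refl
      h-injective zero    (suc w) eq = contradiction (sym eq) (tag-avoids (blocked w))
      h-injective (suc w) zero    eq = contradiction eq (tag-avoids (blocked w))
      h-injective (suc w) (suc x) eq = cong suc (tag-injective (blocked w) (blocked x) eq)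

    partner : ∃ Partner
    partner with any? (λ w → ¬? (F? w) ×-dec ¬? (B? u (σ ⟨$⟩ʳ w)) ×-dec ¬? (B? w (σ ⟨$⟩ʳ u)))
    ... | yes p  = p
    ... | no ¬p = contradiction blocked not-all-blocked
      where
      blocked : ∀ w → Blocked w
      blocked w with partner-or-blocked w
      ... | inj₁ p = contradiction (w , p) ¬p
      ... | inj₂ b = b

  Inv : Permutation′ n → Set
  Inv σ = ∀ u → F u → σ ⟨$⟩ʳ u ≡ φ u

  swap : ∀ σ → Inv σ → ∀ u → ¬ (¬ F u → ¬ B u (σ ⟨$⟩ʳ u)) → _
  swap σ inv u ¬ok = w , inv′ , (λ _ → ¬b) , (λ _ _ → ¬b′)
    where
    ¬Fu : ¬ F u
    ¬Fu Fu = ¬ok (contradiction Fu)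
    bad = decidable-stable (B? u (σ ⟨$⟩ʳ u)) λ ¬bad → ¬ok λ _ → ¬bad
    p = partner σ ¬Fu bad
    w = proj₁ p
    ¬Fw = proj₁ (proj₂ p)
    ¬b  = proj₁ (proj₂ (proj₂ p))
    ¬b′ = proj₂ (proj₂ (proj₂ p))

    inv′ : Inv (transpose u w ∘ₚ σ)
    inv′ x Fx = trans
      (cong (σ ⟨$⟩ʳ_) (transpose-other (λ { refl → ¬Fu Fx }) (λ { refl → ¬Fw Fx })))
      (inv x Fx)

-- b-colourings: decidability and removal of classes without b-vertices.

module Colourings (G : Graph) where
  open Graph G

  BVertex : ∀ {k} → (V → Fin k) → V → Set
  BVertex c v = ∀ j → j ≢ c v → ∃[ w ] v ∼ w × c w ≡ j

  bVertex? : ∀ {k} (c : V → Fin k) → Decidable (BVertex c)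
  bVertex? c v = all? λ j → ¬? (j ≟ c v) →-dec any? λ w → (v ∼? w) ×-dec (c w ≟ j)

  isBColoring? : ∀ {k} → Decidable (IsBColoring G {k})
  isBColoring? c =
    map′ (λ p {u} {v} → p u v) (λ p u v → p) (all? λ u → all? λ v → (u ∼? v) →-dec ¬? (c u ≟ c v))
    ×-dec all? λ i → any? λ v → (c v ≟ i) ×-dec
      all? λ j → ¬? (j ≟ i) →-dec any? λ w → (v ∼? w) ×-dec (c w ≟ j)

  isBColoring-resp : ∀ {k} {c c′ : V → Fin k} → c ≗ c′ → IsBColoring G c → IsBColoring G c′
  isBColoring-resp c≗c′ (proper , rich) =
    (λ {u} {v} u∼v eq → proper u∼v (trans (c≗c′ u) (trans eq (sym (c≗c′ v))))) ,
    λ i → let v , cv , see = rich i in v , trans (sym (c≗c′ v)) cv , λ j j≢i →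
      let w , v∼w , cw = see j j≢i in w , v∼w , trans (sym (c≗c′ w)) cw

  hasBColoring? : ∀ k → Dec (HasBColoring G k)
  hasBColoring? k = ∃-function? isBColoring? isBColoring-resp

  private
    -- Class i has no b-vertex: each of its vertices moves to a colour it does not see.
    module Drop {m} (c : V → Fin (suc m)) (proper : Proper G c) (i : Fin (suc m))
                (poor : ¬ (∃[ v ] c v ≡ i × BVertex c v)) where

      Sees : V → Fin (suc m) → Set
      Sees v j = ∃[ w ] v ∼ w × c w ≡ j

      sees? : ∀ v → Decidable (Sees v)
      sees? v j = any? λ w → (v ∼? w) ×-dec (c w ≟ j)

      free : ∀ v → c v ≡ i → ∃[ j ] i ≢ j × ¬ Sees v j
      free v cv≡i with any? (λ j → ¬? (i ≟ j) ×-dec ¬? (sees? v j))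
      ... | yes p = p
      ... | no ¬p = contradiction (v , cv≡i , see) poor
        where
        see : BVertex c v
        see j j≢cv = decidable-stable (sees? v j) λ unseen →
          ¬p (j , (λ i≡j → j≢cv (trans (sym i≡j) (sym cv≡i))) , unseen)

      recolour : ∀ v → Dec (i ≡ c v) → Fin m
      recolour v (yes i≡cv) = punchOut (proj₁ (proj₂ (free v (sym i≡cv))))
      recolour v (no i≢cv)  = punchOut i≢cv

      c′ : V → Fin m
      c′ v = recolour v (i ≟ c v)

      c′-kept : ∀ {v} (i≢cv : i ≢ c v) → c′ v ≡ punchOut i≢cv
      c′-kept {v} i≢cv with i ≟ c v
      ... | yes i≡cv = contradiction i≡cv i≢cv
      ... | no _     = punchOut-cong i refl

      -- Class `i` is independent, so of two adjacent vertices at most one moves, and it moves to a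
      -- colour that the other does not have.
      proper′ : Proper G c′
      proper′ {u} {v} u∼v with i ≟ c u | i ≟ c v
      ... | yes p | yes q = λ _ → proper u∼v (trans (sym p) q)
      ... | yes p | no q  = λ eq → proj₂ (proj₂ (free u (sym p)))
        (v , u∼v , sym (punchOut-injective (proj₁ (proj₂ (free u (sym p)))) q eq))
      ... | no p  | yes q = λ eq → proj₂ (proj₂ (free v (sym q)))
        (u , ∼-sym u∼v , punchOut-injective p (proj₁ (proj₂ (free v (sym q)))) eq)
      ... | no p  | no q  = λ eq → proper u∼v (punchOut-injective p q eq)

      rich⇒kept : ∀ {v} → BVertex c v → i ≢ c v
      rich⇒kept rich i≡cv = poor (_ , sym i≡cv , rich)

      -- The neighbours that show the surviving colours lie outside class `i` and keep their
      -- colours.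
      bVertex′ : ∀ {v} → BVertex c v → BVertex c′ v
      bVertex′ {v} rich j j≢c′v =
        let w , v∼w , cw = rich (punchIn i j) j≢cv
            i≢cw = λ i≡cw → punchInᵢ≢i i j (sym (trans i≡cw cw))
        in w , v∼w , trans (c′-kept i≢cw) (trans (punchOut-cong i cw) (punchOut-punchIn i))
        where
        j≢cv : punchIn i j ≢ c v
        j≢cv eq = j≢c′v (trans (sym (punchOut-punchIn i))
          (trans (punchOut-cong i eq) (sym (c′-kept (rich⇒kept rich)))))

  -- Recursion on the number of colours. The vertices `b` stay b-vertices of distinct colours at
  -- every removal, so at least `k` colours remain when every class has a b-vertex.
  eliminate : ∀ m {k} (c : V → Fin m) → Proper G c →
    (b : Fin k → V) → Injective _≡_ _≡_ (c ∘ b) → (∀ l → BVertex c (b l)) →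
    ∃[ k′ ] k ≤ k′ × HasBColoring G k′
  eliminate m c proper b cb-inj rich
    with any? (λ i → ¬? (any? λ v → (c v ≟ i) ×-dec bVertex? c v))
  ... | no all-rich = m , injective⇒≤ cb-inj , c , proper , b-vertex
    where
    b-vertex : ∀ i → ∃[ v ] c v ≡ i × (∀ j → j ≢ i → ∃[ w ] v ∼ w × c w ≡ j)
    b-vertex i with any? (λ v → (c v ≟ i) ×-dec bVertex? c v)
    ... | yes (v , refl , see) = v , refl , see
    ... | no poor = contradiction (i , poor) all-rich
  eliminate (suc m) c proper b cb-inj rich | yes (i , poor) =
    eliminate m c′ proper′ b inj (bVertex′ ∘ rich)
    where
    open Drop c proper i poor
    inj : Injective _≡_ _≡_ (c′ ∘ b)
    inj {x} {y} eq = cb-inj (punchOut-injective (rich⇒kept (rich x)) (rich⇒kept (rich y))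
      (trans (sym (c′-kept (rich⇒kept (rich x)))) (trans eq (c′-kept (rich⇒kept (rich y))))))

  ProperOn : ∀ {k} → (V → Set) → (V → Fin k) → Set
  ProperOn D c = ∀ {u v} → D u → D v → u ∼ v → c u ≢ c v

-- Regular graphs: upper bound and greedy extension.

module Regularity {d : ℕ} {G : Graph} (regular : Regular d G) where
  open Graph G
  open Colourings G

  neighbour-enumeration : ∀ v →
    Σ[ e ∈ (Fin d → V) ] Injective _≡_ _≡_ e × (∀ i → v ∼ e i) × (∀ {w} → v ∼ w → ∃[ i ] e i ≡ w)
  neighbour-enumeration v = subst
    (λ k → Σ[ e ∈ (Fin k → V) ] Injective _≡_ _≡_ e × (∀ i → v ∼ e i) × (∀ {w} → v ∼ w → ∃[ i ] e i ≡ w))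
    (regular v) (enumerate (v ∼?_))

  -- A b-vertex of one class sees all other colours, at distinct neighbours, of which there are `d`.
  bColoring-bound : ∀ k → HasBColoring G k → k ≤ suc d
  bColoring-bound zero    _ = z≤n
  bColoring-bound (suc k) (c , _ , rich) =
    let v , cv , see = rich zero
        e , _ , _ , onto = neighbour-enumeration v
        pick : ∀ j → ∃[ i ] c (e i) ≡ suc j
        pick j = let w , v∼w , cw = see (suc j) (λ ()) ; i , ei≡w = onto v∼w in i , trans (cong c ei≡w) cw
    in s≤s (injective⇒≤ {f = proj₁ ∘ pick} λ {x} {y} eq → suc-injective
         (trans (sym (proj₂ (pick x))) (trans (cong (c ∘ e) eq) (proj₂ (pick y)))))

  bChromaticNumber≥ : ∀ {k} → (∃[ k′ ] k ≤ k′ × HasBColoring G k′) → ∃[ φ ] IsBChromaticNumber G φ × k ≤ φ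
  bChromaticNumber≥ (k′ , k≤k′ , h) =
    let φ , has , max = maximum hasBColoring? (suc d) bColoring-bound h
    in φ , (has , max) , ℕ.≤-trans k≤k′ (max k′ h)

  -- The `d` neighbours of `v` cannot show all `d + 1` colours.
  free-colour : ∀ (c : V → Fin (suc d)) v → ∃[ j ] (∀ {w} → v ∼ w → c w ≢ j)
  free-colour c v with any? (λ j → ¬? (any? λ w → (v ∼? w) ×-dec (c w ≟ j)))
  ... | yes (j , unseen) = j , λ v∼w eq → unseen (_ , v∼w , eq)
  ... | no all-seen = contradiction
    (λ {x} {y} eq → trans (sym (proj₂ (pick x))) (trans (cong (c ∘ e) eq) (proj₂ (pick y))))
    (<⇒notInjective {f = proj₁ ∘ pick} ℕ.≤-refl)
    where
    e = proj₁ (neighbour-enumeration v)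
    pick : ∀ j → ∃[ i ] c (e i) ≡ j
    pick j with any? (λ w → (v ∼? w) ×-dec (c w ≟ j))
    ... | no unseen = contradiction (j , unseen) all-seen
    ... | yes (w , v∼w , cw) with i , ei≡w ← proj₂ (proj₂ (proj₂ (neighbour-enumeration v))) v∼w
      = i , trans (cong c ei≡w) cw

  greedy : {D : V → Set} → Decidable D → (c : V → Fin (suc d)) → ProperOn D c →
    Σ[ c′ ∈ (V → Fin (suc d)) ] Proper G c′ × (∀ {v} → D v → c′ v ≡ c v)
  greedy {D} D? c proper =
    let c′ , proper′ , agree = go (allFin order)
    in c′ , proper′ (inj₂ (∈-allFin _)) (inj₂ (∈-allFin _)) , agree
    where
    open DecMembership (_≟_ {order}) using (_∈?_)
    go : ∀ us → Σ[ c′ ∈ (V → Fin (suc d)) ]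
      ProperOn (λ v → D v ⊎ v ∈ us) c′ × (∀ {v} → D v → c′ v ≡ c v)
    go [] = c , (λ { (inj₁ p) (inj₁ q) → proper p q }) , λ _ → refl
    go (u ∷ us) with go us
    ... | c′ , proper′ , agree with D? u ⊎-dec u ∈? us
    ...   | yes done = c′ , (λ p q → proper′ (old p) (old q)) , agree
      where
      old : ∀ {v} → D v ⊎ v ∈ u ∷ us → D v ⊎ v ∈ us
      old (inj₁ p)           = inj₁ p
      old (inj₂ (here refl)) = done
      old (inj₂ (there p))   = inj₂ p
    ...   | no new = c″ , proper″ , agree″
      where
      -- This colour avoids the values at all neighbours of `u`, including provisional values at
      -- vertices not yet treated.
      j = free-colour c′ u
      c″ : V → Fin (suc d)
      c″ v with v ≟ u
      ... | yes _ = proj₁ j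
      ... | no _  = c′ v
      old : ∀ {v} → v ≢ u → D v ⊎ v ∈ u ∷ us → D v ⊎ v ∈ us
      old v≢u (inj₁ p)           = inj₁ p
      old v≢u (inj₂ (here refl)) = contradiction refl v≢u
      old v≢u (inj₂ (there p))   = inj₂ p
      proper″ : ProperOn (λ v → D v ⊎ v ∈ u ∷ us) c″
      proper″ {x} {y} p q x∼y with x ≟ u | y ≟ u
      ... | yes refl | yes refl = contradiction x∼y (∼-irrefl refl)
      ... | yes refl | no _     = proj₂ j x∼y ∘ sym
      ... | no _     | yes refl = proj₂ j (∼-sym x∼y)
      ... | no x≢u   | no y≢u   = proper′ (old x≢u p) (old y≢u q) x∼y
      agree″ : ∀ {v} → D v → c″ v ≡ c v
      agree″ {v} Dv with v ≟ u
      ... | yes refl = contradiction (inj₁ Dv) new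
      ... | no _     = agree Dv

-- Closed neighbourhoods in a graph without 4-cycles.

unique⇒lookup-injective : {A : Set} {xs : List A} → Unique xs → Injective _≡_ _≡_ (lookup xs)
unique⇒lookup-injective (x∉ ∷ u) {zero}  {zero}  eq = refl
unique⇒lookup-injective (x∉ ∷ u) {zero}  {suc j} eq = contradiction eq (All.lookup x∉ (∈-lookup j))
unique⇒lookup-injective (x∉ ∷ u) {suc i} {zero}  eq = contradiction (sym eq) (All.lookup x∉ (∈-lookup i))
unique⇒lookup-injective (x∉ ∷ u) {suc i} {suc j} eq = cong suc (unique⇒lookup-injective u eq)

module Stars {d : ℕ} {G : Graph} (regular : Regular d G) (C₄-free : ¬ Contains G C₄) where
  open Graph G
  open Colourings G
  open Regularity {G = G} regular

  adjacent⇒≢ : ∀ {u v} → u ∼ v → u ≢ v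
  adjacent⇒≢ u∼v u≡v = ∼-irrefl u≡v u∼v

  -- Otherwise `a`, `p`, `b`, `q` would be a 4-cycle.
  common-neighbour-unique : ∀ {a b p q} → a ≢ b → a ∼ p → b ∼ p → a ∼ q → b ∼ q → p ≡ q
  common-neighbour-unique {a} {b} {p} {q} a≢b a∼p b∼p a∼q b∼q = decidable-stable (p ≟ q) λ p≢q →
    C₄-free (lookup (a ∷ p ∷ b ∷ q ∷ []) ,
      unique⇒lookup-injective
        ((adjacent⇒≢ a∼p ∷ a≢b ∷ adjacent⇒≢ a∼q ∷ []) ∷
         (adjacent⇒≢ (∼-sym b∼p) ∷ p≢q ∷ []) ∷
         (adjacent⇒≢ b∼q ∷ []) ∷ [] ∷ []) ,
      λ { {u} {v} (fwd s) → edge u v s ; {u} {v} (bwd s) → ∼-sym (edge v u s) })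
    where
    edge : ∀ u v → Step 4 1 u v → lookup (a ∷ p ∷ b ∷ q ∷ []) u ∼ lookup (a ∷ p ∷ b ∷ q ∷ []) v
    edge 0F 1F _ = a∼p
    edge 1F 2F _ = ∼-sym b∼p
    edge 2F 3F _ = b∼q
    edge 3F 0F _ = ∼-sym a∼q

  Closed : V → V → Set
  Closed x w = w ≡ x ⊎ x ∼ w

  closed? : ∀ x → Decidable (Closed x)
  closed? x w = w ≟ x ⊎-dec x ∼? w

  module _ (x : V) where
    private
      E = neighbour-enumeration x

    -- Closed neighbourhoods are indexed by the colour set itself, so a bijective colouring of a
    -- star is a permutation.
    closed-nbr : Fin (suc d) → V
    closed-nbr zero    = x
    closed-nbr (suc i) = proj₁ E i

    closed-nbr-closed : ∀ i → Closed x (closed-nbr i)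
    closed-nbr-closed zero    = inj₁ refl
    closed-nbr-closed (suc i) = inj₂ (proj₁ (proj₂ (proj₂ E)) i)

    closed-nbr-injective : Injective _≡_ _≡_ closed-nbr
    closed-nbr-injective {zero}  {zero}  eq = refl
    closed-nbr-injective {zero}  {suc j} eq = contradiction eq (adjacent⇒≢ (proj₁ (proj₂ (proj₂ E)) j))
    closed-nbr-injective {suc i} {zero}  eq = contradiction (sym eq) (adjacent⇒≢ (proj₁ (proj₂ (proj₂ E)) i))
    closed-nbr-injective {suc i} {suc j} eq = cong suc (proj₁ (proj₂ E) eq)

    -- Meaningful on the closed neighbourhood of x only.
    position : V → Fin (suc d)
    position w with any? (λ i → closed-nbr i ≟ w)
    ... | yes (i , _) = i
    ... | no _        = zero

    closed-nbr-position : ∀ {w} → Closed x w → closed-nbr (position w) ≡ w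
    closed-nbr-position {w} cw with any? (λ i → closed-nbr i ≟ w)
    ... | yes (_ , eq) = eq
    ... | no missed    = contradiction (index cw) missed
      where
      index : Closed x w → ∃[ i ] closed-nbr i ≡ w
      index (inj₁ refl) = zero , refl
      index (inj₂ x∼w) = let i , eq = proj₂ (proj₂ (proj₂ E)) x∼w in suc i , eq

    position-injective : ∀ {y z} → Closed x y → Closed x z → position y ≡ position z → y ≡ z
    position-injective cy cz eq =
      trans (sym (closed-nbr-position cy)) (trans (cong closed-nbr eq) (closed-nbr-position cz))

  Rainbow : (V → Fin (suc d)) → V → Set
  Rainbow c x = ∀ {y z} → Closed x y → Closed x z → c y ≡ c z → y ≡ z

  -- The `d + 1` vertices of the closed neighbourhood have distinct colours, hence take every
  -- colour.
  rainbow⇒bVertex : ∀ {c x} → Rainbow c x → BVertex c x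
  rainbow⇒bVertex {c} {x} rainbow j j≢cx
    with i , eq ← injective⇒surjective {g = c ∘ closed-nbr x}
           (λ {y} {z} → closed-nbr-injective x ∘ rainbow (closed-nbr-closed x y) (closed-nbr-closed x z)) j
    with closed-nbr-closed x i
  ... | inj₁ at-x = contradiction (trans (sym eq) (cong c at-x)) j≢cx
  ... | inj₂ x∼w  = closed-nbr x i , x∼w , eq

  -- Consistent colourings of the stars around a vertex.

  module Centre (v : V) where
    open DecMembership (_≟_ {order}) using (_∈?_)

    -- The union of the stars at `v` and at the leaves `L`; the leaves themselves will be neighbours
    -- of `v`.
    Dom : List V → V → Set
    Dom L w = Closed v w ⊎ Any (_∼ w) L

    dom? : ∀ L → Decidable (Dom L)
    dom? L w = closed? v w ⊎-dec Any.any? (_∼? w) L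

    record StarColouring (L : List V) : Set where
      field
        colour  : V → Fin (suc d)
        centre  : Rainbow colour v
        leaves  : ∀ {l} → l ∈ L → Rainbow colour l
        proper  : ProperOn (Dom L) colour

    open StarColouring

    rainbow⇒proper : ∀ {c x y z} → Rainbow c x → Closed x y → Closed x z → y ∼ z → c y ≢ c z
    rainbow⇒proper rainbow cy cz y∼z eq = adjacent⇒≢ y∼z (rainbow cy cz eq)

    single-star : StarColouring []
    single-star = record
      { colour = position v
      ; centre = position-injective v
      ; leaves = λ ()
      ; proper = λ { (inj₁ cy) (inj₁ cz) → rainbow⇒proper {c = position v} (position-injective v) cy cz }
      }

    -- Leaves adjacent to x are left out because an edge between the private
    -- neighbours of two adjacent leaves would close a 4-cycle.
    nonadjacent : V → List V → List V
    nonadjacent x = filter (λ l → ¬? (x ∼? l))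

    -- The map `ρ` bounds by `r` the number of vertices common to the stars at `v` and `x`, whose
    -- colours are prescribed. Each leaf nonadjacent to `x` counts twice in `small`: for the colours
    -- it forbids to a vertex and for the vertices to which it forbids a colour.
    module AddStar {L : List V} (S : StarColouring L) (L⊆N : ∀ {l} → l ∈ L → v ∼ l)
                   {x : V} (v∼x : v ∼ x) (x∉L : x ∉ L)
                   {r : ℕ} (ρ : V → Fin r)
                   (ρ-inj : ∀ {y z} → Closed v y → Closed x y → Closed v z → Closed x z → ρ y ≡ ρ z → y ≡ z)
                   (small : r + (length (nonadjacent x L) + length (nonadjacent x L)) ≤ suc d) where

      private
        c  = colour S
        L′ = nonadjacent x L

      meet-leaf : ∀ {l w} → l ∈ L → l ∼ w → x ∼ w → Closed v w
      meet-leaf {l} l∈L l∼w x∼w =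
        inj₁ (common-neighbour-unique (λ { refl → x∉L l∈L }) l∼w x∼w (∼-sym (L⊆N l∈L)) (∼-sym v∼x))

      -- The star at `x` meets the earlier stars only inside the star at `v`: the only common
      -- neighbour of `x` and another leaf is `v`.
      meet : ∀ {w} → Dom L w → Closed x w → Closed v w
      meet (inj₁ cw) _           = cw
      meet (inj₂ p) (inj₁ refl) = inj₂ v∼x
      meet (inj₂ p) (inj₂ x∼w)  = let l , l∈L , l∼w = find p in meet-leaf l∈L l∼w x∼w

      Conflict : V → Fin (suc d) → V → V → Set
      Conflict u k l y = l ∼ y × y ∼ u × y ≢ x × c y ≡ k

      Fixed : Fin (suc d) → Set
      Fixed i = Closed v (closed-nbr x i)

      -- Stated with `Any` so that the index of the leaf responsible serves as the label of a
      -- conflict.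
      Forbidden : Fin (suc d) → Fin (suc d) → Set
      Forbidden i k = Any (λ l → ∃ (Conflict (closed-nbr x i) k l)) L′

      forbidden? : ∀ i → Decidable (Forbidden i)
      forbidden? i k = Any.any? (λ l → any? λ y →
        (l ∼? y) ×-dec (y ∼? closed-nbr x i) ×-dec ¬? (y ≟ x) ×-dec (c y ≟ k)) L′

      not-fixed⇒adjacent : ∀ {u} → Closed x u → ¬ Closed v u → x ∼ u
      not-fixed⇒adjacent (inj₁ refl) ¬cv = contradiction (inj₂ v∼x) ¬cv
      not-fixed⇒adjacent (inj₂ x∼u)  _   = x∼u

      member : ∀ i → lookup L′ i ∈ L
      member i = proj₁ (∈-filter⁻ (λ l → ¬? (x ∼? l)) {xs = L} (∈-lookup {xs = L′} i))

      -- The vertices `u` and `l` differ, so they have only one common neighbour, and it carries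
      -- both colours.
      same-colour : ∀ {u k k′ l} → ¬ Closed v u → v ∼ l →
        ∃ (Conflict u k l) → ∃ (Conflict u k′ l) → k ≡ k′
      same-colour ¬cu v∼l (y , l∼y , y∼u , _ , refl) (y′ , l∼y′ , y′∼u , _ , refl) =
        cong c (common-neighbour-unique (λ { refl → ¬cu (inj₂ v∼l) }) l∼y (∼-sym y∼u) l∼y′ (∼-sym y′∼u))

      -- The star at `l` is rainbow, so a single `y` has colour `k`, and `u` and `u′` are both
      -- common neighbours of `y` and `x`.
      same-vertex : ∀ {u u′ k l} → x ∼ u → x ∼ u′ → l ∈ L →
        ∃ (Conflict u k l) → ∃ (Conflict u′ k l) → u ≡ u′
      same-vertex x∼u x∼u′ l∈L (y , l∼y , y∼u , y≢x , refl) (y′ , l∼y′ , y′∼u′ , _ , eq)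
        with refl ← leaves S l∈L (inj₂ l∼y′) (inj₂ l∼y) eq
        = common-neighbour-unique y≢x y∼u x∼u y′∼u′ x∼u′

      abstract
        permuted : Σ[ σ ∈ Permutation′ (suc d) ]
          (∀ i → Fixed i → σ ⟨$⟩ʳ i ≡ c (closed-nbr x i)) × (∀ i → ¬ Fixed i → ¬ Forbidden i (σ ⟨$⟩ʳ i))
        permuted = avoiding-permutation {F = Fixed} {B = Forbidden}
          (λ i → closed? v (closed-nbr x i)) forbidden?
          (c ∘ closed-nbr x) (λ {i} {j} → fixed-colours {i} {j})
          (ρ ∘ closed-nbr x) (λ {i} {j} → fixed-labels {i} {j})
          Any.index (λ {i} → same-label⇒same-colour {i}) (λ {i} {j} → same-label⇒same-vertex {i} {j})
          small
          where
          fixed-colours : ∀ {i j} → Fixed i → Fixed j → c (closed-nbr x i) ≡ c (closed-nbr x j) → i ≡ j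
          fixed-colours Fi Fj = closed-nbr-injective x ∘ centre S Fi Fj

          fixed-labels : ∀ {i j} → Fixed i → Fixed j → ρ (closed-nbr x i) ≡ ρ (closed-nbr x j) → i ≡ j
          fixed-labels {i} {j} Fi Fj =
            closed-nbr-injective x ∘ ρ-inj Fi (closed-nbr-closed x i) Fj (closed-nbr-closed x j)

          conflict-at : ∀ {i k k′ j} (b : Forbidden i k) (b′ : Forbidden j k′) → Any.index b ≡ Any.index b′ →
            ∃ (Conflict (closed-nbr x j) k′ (lookup L′ (Any.index b)))
          conflict-at {k′ = k′} {j} b b′ eq =
            subst (λ i → ∃ (Conflict (closed-nbr x j) k′ (lookup L′ i))) (sym eq) (lookup-index b′)

          same-label⇒same-colour : ∀ {i k k′} → ¬ Fixed i → (b : Forbidden i k) (b′ : Forbidden i k′) →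
            Any.index b ≡ Any.index b′ → k ≡ k′
          same-label⇒same-colour {i} ¬Fi b b′ eq =
            same-colour ¬Fi (L⊆N (member (Any.index b))) (lookup-index b) (conflict-at {i} {j = i} b b′ eq)

          same-label⇒same-vertex : ∀ {i j k} → ¬ Fixed i → ¬ Fixed j → (b : Forbidden i k) (b′ : Forbidden j k) →
            Any.index b ≡ Any.index b′ → i ≡ j
          same-label⇒same-vertex {i} {j} ¬Fi ¬Fj b b′ eq = closed-nbr-injective x (same-vertex
            (not-fixed⇒adjacent (closed-nbr-closed x i) ¬Fi)
            (not-fixed⇒adjacent (closed-nbr-closed x j) ¬Fj)
            (member (Any.index b)) (lookup-index b) (conflict-at {i} {j = j} b b′ eq))

      σ : Fin (suc d) → Fin (suc d)
      σ = proj₁ permuted ⟨$⟩ʳ_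

      c′ : V → Fin (suc d)
      c′ w with closed? x w
      ... | yes _ = σ (position x w)
      ... | no _  = c w

      c′-star : ∀ {w} → Closed x w → c′ w ≡ σ (position x w)
      c′-star {w} cw with closed? x w
      ... | yes _ = refl
      ... | no ¬p = contradiction cw ¬p

      -- By `meet`, an old vertex in the star at `x` is fixed, and there the permutation agrees with
      -- the old colours.
      c′-old : ∀ {w} → Dom L w → c′ w ≡ c w
      c′-old {w} dw with closed? x w
      ... | no _   = refl
      ... | yes cw = trans (proj₁ (proj₂ permuted) (position x w) (subst (Closed v) (sym at-w) (meet dw cw)))
                           (cong c at-w)
        where at-w = closed-nbr-position x cw

      c′-avoids : ∀ {w l y} → x ∼ w → ¬ Closed v w → l ∈ L′ → l ∼ y → y ∼ w → y ≢ x → c y ≢ c′ w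
      c′-avoids {w} {l} {y} x∼w ¬cw l∈L′ l∼y y∼w y≢x eq =
        proj₂ (proj₂ permuted) (position x w) (¬cw ∘ subst (Closed v) at-w)
          (lose l∈L′ (y , l∼y , subst (y ∼_) (sym at-w) y∼w , y≢x , trans eq (c′-star (inj₂ x∼w))))
        where at-w = closed-nbr-position x (inj₂ x∼w)

      rainbow-old : ∀ {z} → (∀ {w} → Closed z w → Dom L w) → Rainbow c z → Rainbow c′ z
      rainbow-old dom rainbow cy cw eq =
        rainbow cy cw (trans (sym (c′-old (dom cy))) (trans eq (c′-old (dom cw))))

      rainbow-new : Rainbow c′ x
      rainbow-new cy cz eq = position-injective x cy cz (σ-injective
        (trans (sym (c′-star cy)) (trans eq (c′-star cz))))
        where
        τ = proj₁ permuted
        σ-injective : ∀ {i j} → σ i ≡ σ j → i ≡ j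
        σ-injective e = trans (sym (inverseˡ τ)) (trans (cong (τ ⟨$⟩ˡ_) e) (inverseˡ τ))

      leaf-dom : ∀ {l w} → l ∈ L → Closed l w → Dom L w
      leaf-dom l∈L (inj₁ refl) = inj₁ (inj₂ (L⊆N l∈L))
      leaf-dom l∈L (inj₂ l∼w)  = inj₂ (lose l∈L l∼w)

      -- If `z` lies in the star at `x`, the rainbow property separates the colours. By `outside`,
      -- equal colours allow no other `z`.
      new-old : ∀ {y z} → x ∼ y → ¬ Closed v y → Dom L z → y ∼ z → c′ y ≢ c′ z
      new-old {y} {z} x∼y ¬cy dz y∼z eq = outside dz λ cz →
        adjacent⇒≢ y∼z (rainbow-new (inj₂ x∼y) cz eq)
        where
        outside : Dom L z → ¬ ¬ Closed x z
        outside (inj₁ (inj₁ refl)) _ = ¬cy (inj₂ (∼-sym y∼z))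
        outside (inj₁ (inj₂ v∼z)) ¬cz =
          -- Both `z` and `x` are common neighbours of `v` and `y`, so `z` is `x`.
          ¬cz (inj₁ (common-neighbour-unique (λ { refl → ¬cy (inj₁ refl) }) v∼z y∼z v∼x (∼-sym x∼y)))
        outside (inj₂ p) ¬cz with l , l∈L , l∼z ← find p with x ∼? l
        -- Both `l` and `y` are common neighbours of `x` and `z`, so `y` would be the leaf `l`, a
        -- neighbour of `v`.
        ... | yes x∼l = ¬cy (inj₂ (subst (v ∼_)
          (common-neighbour-unique (λ { refl → ¬cz (inj₁ refl) }) x∼l (∼-sym l∼z) x∼y (∼-sym y∼z)) (L⊆N l∈L)))
        ... | no x≁l = c′-avoids x∼y ¬cy (∈-filter⁺ (λ l → ¬? (x ∼? l)) l∈L x≁l) l∼z (∼-sym y∼z)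
          (¬cz ∘ inj₁) (trans (sym (c′-old dz)) (sym eq))

      split : ∀ {w} → Dom (x ∷ L) w → Dom L w ⊎ (x ∼ w × ¬ Closed v w)
      split {w} d with closed? v w
      split d                  | yes cw = inj₁ (inj₁ cw)
      split (inj₁ cw)          | no ¬cw = contradiction cw ¬cw
      split (inj₂ (here x∼w))  | no ¬cw = inj₂ (x∼w , ¬cw)
      split (inj₂ (there p))   | no ¬cw = inj₁ (inj₂ p)

      proper-new : ProperOn (Dom (x ∷ L)) c′
      proper-new {y} {z} dy dz y∼z with split dy | split dz
      ... | inj₁ p         | inj₁ q         = λ eq →
        proper S p q y∼z (trans (sym (c′-old p)) (trans eq (c′-old q)))
      ... | inj₁ p         | inj₂ (x∼z , ¬cz) = new-old x∼z ¬cz p (∼-sym y∼z) ∘ sym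
      ... | inj₂ (x∼y , ¬cy) | inj₁ q         = new-old x∼y ¬cy q y∼z
      ... | inj₂ (x∼y , _)   | inj₂ (x∼z , _) = rainbow⇒proper {c = c′} rainbow-new (inj₂ x∼y) (inj₂ x∼z) y∼z

      extended : StarColouring (x ∷ L)
      extended = record
        { colour = c′
        ; centre = rainbow-old inj₁ (centre S)
        ; leaves = λ { (here refl) → rainbow-new ; (there l∈L) → rainbow-old (leaf-dom l∈L) (leaves S l∈L) }
        ; proper = proper-new
        }

    record StarSet (L : List V) : Set where
      field
        neighbours-only : ∀ {l} → l ∈ L → v ∼ l
        unique          : Unique L
        colouring       : StarColouring L

    open StarSet

    empty-starSet : StarSet []
    empty-starSet = record { neighbours-only = λ () ; unique = [] ; colouring = single-star }

    extend-starSet : ∀ {L} (S : StarSet L) {x} (v∼x : v ∼ x) (x∉L : x ∉ L) → StarColouring (x ∷ L) → StarSet (x ∷ L)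
    extend-starSet S v∼x x∉L C = record
      { neighbours-only = λ { (here refl) → v∼x ; (there l∈L) → neighbours-only S l∈L }
      ; unique          = ¬Any⇒All¬ _ x∉L ∷ unique S
      ; colouring       = C
      }

    -- The closed neighbourhoods of `v` and `x` share `v`, `x` and at most one more vertex, the apex
    -- of a triangle on the edge between them; hence the 3.
    add-star : ∀ {L} (S : StarSet L) {x} → v ∼ x → x ∉ L →
      3 + (length (nonadjacent x L) + length (nonadjacent x L)) ≤ suc d → StarSet (x ∷ L)
    add-star S {x} v∼x x∉L small = extend-starSet S v∼x x∉L
      (AddStar.extended (colouring S) (neighbours-only S) v∼x x∉L ρ ρ-inj small)
      where
      ρ : V → Fin 3
      ρ w with w ≟ v | w ≟ x
      ... | yes _ | _     = 0F
      ... | no _  | yes _ = 1F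
      ... | no _  | no _  = 2F

      ρ-inj : ∀ {y z} → Closed v y → Closed x y → Closed v z → Closed x z → ρ y ≡ ρ z → y ≡ z
      ρ-inj {y} {z} vy xy vz xz eq with y ≟ v | y ≟ x | z ≟ v | z ≟ x
      ... | yes refl | _        | yes refl | _        = refl
      ... | no _     | yes refl | no _     | yes refl = refl
      ρ-inj (inj₂ v∼y) (inj₂ x∼y) (inj₂ v∼z) (inj₂ x∼z) eq | no _ | no _ | no _ | no _ =
        common-neighbour-unique (adjacent⇒≢ v∼x) v∼y x∼y v∼z x∼z
      ρ-inj (inj₁ y≡v) _ _ _ _ | no y≢v | no _   | no _ | no _ = contradiction y≡v y≢v
      ρ-inj _ (inj₁ y≡x) _ _ _ | no _   | no y≢x | no _ | no _ = contradiction y≡x y≢x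
      ρ-inj _ _ (inj₁ z≡v) _ _ | no _ | no _ | no z≢v | no _   = contradiction z≡v z≢v
      ρ-inj _ _ _ (inj₁ z≡x) _ | no _ | no _ | no _   | no z≢x = contradiction z≡x z≢x
      ρ-inj _ _ _ _ () | yes _ | _     | no _  | yes _
      ρ-inj _ _ _ _ () | yes _ | _     | no _  | no _
      ρ-inj _ _ _ _ () | no _  | yes _ | yes _ | _
      ρ-inj _ _ _ _ () | no _  | no _  | yes _ | _
      ρ-inj _ _ _ _ () | no _  | yes _ | no _  | no _
      ρ-inj _ _ _ _ () | no _  | no _  | no _  | yes _

    -- Without a triangle on the edge from `v` to `x` only `v` and `x` are shared, so the 3 drops to
    -- 2.
    add-star-no-triangle : ∀ {L} (S : StarSet L) {x} → v ∼ x → x ∉ L → (∀ w → v ∼ w → ¬ x ∼ w) →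
      2 + (length (nonadjacent x L) + length (nonadjacent x L)) ≤ suc d → StarSet (x ∷ L)
    add-star-no-triangle S {x} v∼x x∉L no-triangle small = extend-starSet S v∼x x∉L
      (AddStar.extended (colouring S) (neighbours-only S) v∼x x∉L ρ ρ-inj small)
      where
      ρ : V → Fin 2
      ρ w with w ≟ v
      ... | yes _ = 0F
      ... | no _  = 1F

      only-x : ∀ {y} → y ≢ v → Closed v y → Closed x y → y ≡ x
      only-x y≢v (inj₁ y≡v) _          = contradiction y≡v y≢v
      only-x y≢v (inj₂ _)   (inj₁ y≡x) = y≡x
      only-x y≢v (inj₂ v∼y) (inj₂ x∼y) = contradiction x∼y (no-triangle _ v∼y)

      ρ-inj : ∀ {y z} → Closed v y → Closed x y → Closed v z → Closed x z → ρ y ≡ ρ z → y ≡ z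
      ρ-inj {y} {z} vy xy vz xz eq with y ≟ v | z ≟ v
      ... | yes refl | yes refl = refl
      ... | no y≢v   | no z≢v   = trans (only-x y≢v vy xy) (sym (only-x z≢v vz xz))

    -- Choosing the leaves and counting them.

    fresh-neighbour : ∀ Y → length Y < d → ∃[ u ] v ∼ u × u ∉ Y
    fresh-neighbour Y short with any? (λ u → (v ∼? u) ×-dec ¬? (u ∈? Y))
    ... | yes found = found
    ... | no ¬found = contradiction
      (λ {i} {j} eq → e-inj (trans (lookup-index (covered i))
        (trans (cong (lookup Y) eq) (sym (lookup-index (covered j))))))
      (<⇒notInjective {f = Any.index ∘ covered} short)
      where
      E = neighbour-enumeration v
      e-inj = proj₁ (proj₂ E)
      covered : ∀ i → proj₁ E i ∈ Y
      covered i = decidable-stable (_ ∈? Y) λ u∉Y → ¬found (_ , proj₁ (proj₂ (proj₂ E)) i , u∉Y)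

    nonadjacent-length : ∀ {x t} L → length L ≡ t → length (nonadjacent x L) + length (nonadjacent x L) ≤ t + t
    nonadjacent-length {x} L refl = ℕ.+-mono-≤ shorter shorter
      where shorter = length-filter (λ l → ¬? (x ∼? l)) L

    stars : (∀ {a b} → v ∼ a → v ∼ b → ¬ a ∼ b) → ∀ t → t + t ≤ suc d → ∃[ L ] length L ≡ t × StarSet L
    stars no-triangle zero    _ = [] , refl , empty-starSet
    stars no-triangle (suc t) (s≤s t+1+t≤d)
      with L , refl , S ← stars no-triangle t (ℕ.≤-trans (ℕ.+-monoʳ-≤ t (ℕ.n≤1+n t)) (ℕ.m≤n⇒m≤1+n t+1+t≤d))
      with x , v∼x , x∉L ← fresh-neighbour L (ℕ.m+n≤o⇒n≤o t t+1+t≤d)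
      = x ∷ L , refl , add-star-no-triangle S v∼x x∉L (λ w v∼w x∼w → no-triangle v∼x v∼w x∼w)
          -- With `t` leaves present, `2 + 2t ≤ d + 1` is needed, which is the hypothesis for
          -- `t + 1` leaves.
          (s≤s (ℕ.≤-trans (s≤s (nonadjacent-length L refl)) (subst (_≤ d) (ℕ.+-suc t t) t+1+t≤d)))

    module _ {a b} (v∼a : v ∼ a) (v∼b : v ∼ b) (a∼b : a ∼ b) where

      -- The leaf `a` goes first, and `b` is held back by always choosing a neighbour outside
      -- `b ∷ L`.
      stars-avoiding : ∀ t → suc t + suc t ≤ d → ∃[ L ] length L ≡ suc t × a ∈ L × b ∉ L × StarSet L
      stars-avoiding zero 2≤d = a ∷ [] , refl , here refl , (λ { (here refl) → ∼-irrefl refl a∼b }) ,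
        add-star empty-starSet v∼a (λ ()) (s≤s 2≤d)
      stars-avoiding (suc t) small
        with L , len , a∈L , b∉L , S ← stars-avoiding t
          (ℕ.≤-trans (ℕ.+-mono-≤ (ℕ.n≤1+n (suc t)) (ℕ.n≤1+n (suc t))) small)
        with x , v∼x , x∉ ← fresh-neighbour (b ∷ L)
          (ℕ.≤-trans (s≤s (s≤s (ℕ.≤-trans (ℕ.≤-reflexive len) (ℕ.m≤n⇒m≤o+n t (ℕ.n≤1+n (suc t)))))) small)
        = x ∷ L , cong suc len , there a∈L , (λ { (here refl) → x∉ (here refl) ; (there p) → b∉L p }) ,
          add-star S v∼x (x∉ ∘ there)
            (s≤s (ℕ.≤-trans (s≤s (s≤s (nonadjacent-length L len))) (subst (_≤ d) (cong suc (ℕ.+-suc (suc t) (suc t))) small)))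

      -- The star at b comes last: it has no conflict with the star at a.
      stars-triangle : ∀ t → suc t + suc t ≤ d → ∃[ L ] length L ≡ suc (suc t) × StarSet L
      stars-triangle t small with L , len , a∈L , b∉L , S ← stars-avoiding t small =
        b ∷ L , cong suc len , add-star S v∼b b∉L
          (s≤s (ℕ.≤-trans (s≤s (s≤s (ℕ.+-mono-≤ fewer fewer))) (subst (_≤ d) (cong suc (ℕ.+-suc t t)) small)))
        where
        fewer : length (nonadjacent b L) ≤ t
        fewer = ℕ.≤-pred (subst (length (nonadjacent b L) <_) len
          (filter-notAll (λ l → ¬? (b ∼? l)) L (lose a∈L λ b≁a → b≁a (∼-sym a∼b))))

    -- After greedy extension `v` and its leaves are b-vertices. They all lie in the rainbow star at
    -- `v`, so their colours are distinct and survive `eliminate`.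
    starSet⇒bColoring : ∀ {L} → StarSet L → ∃[ k ] suc (length L) ≤ k × HasBColoring G k
    starSet⇒bColoring {L} S with c , proper-c , agree ← greedy (dom? L) (colour (colouring S)) (proper (colouring S)) =
      eliminate (suc d) c proper-c (lookup (v ∷ L)) colours-distinct
        (λ i → rainbow⇒bVertex (rainbow-c (∈-lookup {xs = v ∷ L} i)))
      where
      C = colouring S

      restrict : ∀ {x} → (∀ {w} → Closed x w → Dom L w) → Rainbow (colour C) x → Rainbow c x
      restrict dom rainbow cy cz eq = rainbow cy cz (trans (sym (agree (dom cy))) (trans eq (agree (dom cz))))

      rainbow-c : ∀ {x} → x ∈ v ∷ L → Rainbow c x
      rainbow-c (here refl)  = restrict inj₁ (centre C)
      rainbow-c (there x∈L) = restrict
        (λ { (inj₁ refl) → inj₁ (inj₂ (neighbours-only S x∈L)) ; (inj₂ x∼w) → inj₂ (lose x∈L x∼w) })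
        (leaves C x∈L)

      closed : ∀ i → Closed v (lookup (v ∷ L) i)
      closed zero    = inj₁ refl
      closed (suc i) = inj₂ (neighbours-only S (∈-lookup i))

      colours-distinct : Injective _≡_ _≡_ (c ∘ lookup (v ∷ L))
      colours-distinct {i} {j} eq = unique⇒lookup-injective
        (¬Any⇒All¬ _ (λ v∈L → ∼-irrefl refl (neighbours-only S v∈L)) ∷ unique S)
        (rainbow-c (here refl) (closed i) (closed j) eq)

  -- The two lower bounds.

  open Centre using (stars; stars-triangle; starSet⇒bColoring)

  ⌊n/2⌋+⌊n/2⌋≤n : ∀ n → ⌊ n /2⌋ + ⌊ n /2⌋ ≤ n
  ⌊n/2⌋+⌊n/2⌋≤n n = ℕ.≤-trans (ℕ.+-monoʳ-≤ ⌊ n /2⌋ (ℕ.⌊n/2⌋≤⌈n/2⌉ n)) (ℕ.≤-reflexive (ℕ.⌊n/2⌋+⌈n/2⌉≡n n))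

  distinct⇒2≤ : ∀ {n} {i j : Fin n} → i ≢ j → 2 ≤ n
  distinct⇒2≤ {suc zero} {0F} {0F} i≢j = contradiction refl i≢j
  distinct⇒2≤ {suc (suc n)}        _   = s≤s (s≤s z≤n)

  triangle-bound : ∀ {v a b} → v ∼ a → v ∼ b → a ∼ b → ∃[ k ] ⌊ d + 4 /2⌋ ≤ k × HasBColoring G k
  triangle-bound {v} {a} {b} v∼a v∼b a∼b
    with _ , _ , _ , onto ← neighbour-enumeration v
    with i , refl ← onto v∼a | j , refl ← onto v∼b
    = subst (λ n → ∃[ k ] ⌊ n /2⌋ ≤ k × HasBColoring G k) (ℕ.+-comm 4 d)
        (large d refl (distinct⇒2≤ {i = i} {j} λ { refl → ∼-irrefl refl a∼b }))
    where
    -- For `d = n + 2` there are `⌊ n /2⌋ + 2` leaves; with the centre this makes `⌊ n /2⌋ + 3`,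
    -- which is `⌊ d + 4 /2⌋`.
    large : ∀ n → n ≡ d → 2 ≤ n → ∃[ k ] 2 + ⌊ n /2⌋ ≤ k × HasBColoring G k
    large (suc zero) _ (s≤s ())
    large (suc (suc n)) refl _
      with L , len , S ← stars-triangle v v∼a v∼b a∼b ⌊ n /2⌋
        (s≤s (subst (_≤ suc n) (sym (ℕ.+-suc ⌊ n /2⌋ ⌊ n /2⌋)) (s≤s (⌊n/2⌋+⌊n/2⌋≤n n))))
      with k , ≤k , h ← starSet⇒bColoring v S
      = k , subst (λ l → suc l ≤ k) len ≤k , h

  vertex : V
  vertex = fromℕ< (>-nonZero⁻¹ order)

  -- One vertex decides: either a triangle passes through it and the stronger bound applies, or
  -- `⌊ suc d /2⌋` stars fit around it, and the centre adds one.
  regular-bound : ∃[ k ] ⌊ d + 3 /2⌋ ≤ k × HasBColoring G k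
  regular-bound
    with any? (λ a → any? λ b → (vertex ∼? a) ×-dec (vertex ∼? b) ×-dec (a ∼? b))
  ... | yes (a , b , v∼a , v∼b , a∼b) =
    let k , ≤k , h = triangle-bound v∼a v∼b a∼b
    in k , ℕ.≤-trans (ℕ.⌊n/2⌋-mono (ℕ.+-monoʳ-≤ d (ℕ.n≤1+n 3))) ≤k , h
  ... | no none
    with L , len , S ← stars vertex (λ p q r → none (_ , _ , p , q , r)) ⌊ suc d /2⌋ (⌊n/2⌋+⌊n/2⌋≤n (suc d))
    with k , ≤k , h ← starSet⇒bColoring vertex S
    = k , subst (λ n → ⌊ n /2⌋ ≤ k) (ℕ.+-comm 3 d) (subst (λ l → suc l ≤ k) len ≤k) , h

  contains-triangle-bound : Contains G triangle → ∃[ k ] ⌊ d + 4 /2⌋ ≤ k × HasBColoring G k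
  contains-triangle-bound (_ , _ , hom) =
    triangle-bound (hom {0F} {1F} (fwd refl)) (hom {0F} {2F} (bwd refl)) (hom {1F} {2F} (fwd refl))

-- The Petersen graph.

unique-common-neighbours⇒C₄-free : (G : Graph) → let open Graph G in
  (∀ a b → a ∼ b → ∀ c → b ∼ c → a ≢ c → ∀ e → c ∼ e → e ∼ a → b ≡ e) → ¬ Contains G C₄
unique-common-neighbours⇒C₄-free G unique (f , f-inj , hom)
  with () ← f-inj {1F} {3F} (unique (f 0F) (f 1F) (hom {0F} {1F} (fwd refl)) (f 2F) (hom {1F} {2F} (fwd refl))
    (λ eq → contradiction (f-inj {0F} {2F} eq) λ ()) (f 3F) (hom {2F} {3F} (fwd refl)) (hom {3F} {0F} (fwd refl)))

module Petersen where
  open Graph petersen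
  open Colourings petersen
  open DecMembership (_≟_ {10}) using (_∈?_)

  petersen-regular : Regular 3 petersen
  petersen-regular = from-yes (all? λ v → degree v ℕ.≟ 3)

  -- Adjacency conditions are interleaved with the quantifiers, so the exhaustive check drops a
  -- branch at its first missing edge.
  petersen-common-neighbours : ∀ a b → a ∼ b → ∀ c → b ∼ c → a ≢ c → ∀ e → c ∼ e → e ∼ a → b ≡ e
  petersen-common-neighbours = from-yes
    (all? λ a → all? λ b → (a ∼? b) →-dec all? λ c → (b ∼? c) →-dec ¬? (a ≟ c) →-dec
     all? λ e → (c ∼? e) →-dec (e ∼? a) →-dec (b ≟ e))

  petersen-C₄-free : ¬ Contains petersen C₄
  petersen-C₄-free = unique-common-neighbours⇒C₄-free petersen petersen-common-neighbours

  petersen-3-colouring : Fin 10 → Fin 3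
  petersen-3-colouring = Vec.lookup (0F ∷ 1F ∷ 0F ∷ 1F ∷ 2F ∷ 1F ∷ 0F ∷ 2F ∷ 2F ∷ 1F ∷ [])

  petersen-neighbours : Fin 10 → List (Fin 10)
  petersen-neighbours = Vec.lookup
    ((1F ∷ 4F ∷ 5F ∷ []) ∷ (0F ∷ 2F ∷ 6F ∷ []) ∷ (1F ∷ 3F ∷ 7F ∷ []) ∷ (2F ∷ 4F ∷ 8F ∷ []) ∷ (3F ∷ 0F ∷ 9F ∷ []) ∷
     (0F ∷ 7F ∷ 8F ∷ []) ∷ (1F ∷ 8F ∷ 9F ∷ []) ∷ (2F ∷ 5F ∷ 9F ∷ []) ∷ (3F ∷ 5F ∷ 6F ∷ []) ∷ (4F ∷ 6F ∷ 7F ∷ []) ∷ [])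

  ∼⇒∈-petersen-neighbours : ∀ v w → v ∼ w → w ∈ petersen-neighbours v
  ∼⇒∈-petersen-neighbours = from-yes (all? λ v → all? λ w → (v ∼? w) →-dec (w ∈? petersen-neighbours v))

  -- The b-vertex condition, with the search for neighbours cut to the three listed ones.
  Rich : (Fin 10 → Fin 4) → Set
  Rich c = ∀ i → ∃[ v ] c v ≡ i × (∀ j → j ≢ i → Any (λ w → c w ≡ j) (petersen-neighbours v))

  rich? : ∀ c → Dec (Rich c)
  rich? c = all? λ i → any? λ v → (c v ≟ i) ×-dec
    all? λ j → ¬? (j ≟ i) →-dec Any.any? (λ w → c w ≟ j) (petersen-neighbours v)

  -- Each edge is tested as soon as both of its ends have colours, so only proper colourings reach
  -- the test for `Rich`.
  petersen-search : ∀ c₀ c₁ → c₀ ≢ c₁ → ∀ c₂ → c₁ ≢ c₂ → ∀ c₃ → c₂ ≢ c₃ → ∀ c₄ → c₃ ≢ c₄ → c₄ ≢ c₀ →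
    ∀ c₅ → c₀ ≢ c₅ → ∀ c₆ → c₁ ≢ c₆ → ∀ c₇ → c₂ ≢ c₇ → c₅ ≢ c₇ → ∀ c₈ → c₃ ≢ c₈ → c₆ ≢ c₈ → c₈ ≢ c₅ →
    ∀ c₉ → c₄ ≢ c₉ → c₇ ≢ c₉ → c₉ ≢ c₆ →
    ¬ Rich (Vec.lookup (c₀ ∷ c₁ ∷ c₂ ∷ c₃ ∷ c₄ ∷ c₅ ∷ c₆ ∷ c₇ ∷ c₈ ∷ c₉ ∷ []))
  petersen-search = from-yes (
    all? λ c₀ → all? λ c₁ → ¬? (c₀ ≟ c₁) →-dec all? λ c₂ → ¬? (c₁ ≟ c₂) →-dec all? λ c₃ → ¬? (c₂ ≟ c₃) →-dec
    all? λ c₄ → ¬? (c₃ ≟ c₄) →-dec ¬? (c₄ ≟ c₀) →-dec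
    all? λ c₅ → ¬? (c₀ ≟ c₅) →-dec all? λ c₆ → ¬? (c₁ ≟ c₆) →-dec
    all? λ c₇ → ¬? (c₂ ≟ c₇) →-dec ¬? (c₅ ≟ c₇) →-dec
    all? λ c₈ → ¬? (c₃ ≟ c₈) →-dec ¬? (c₆ ≟ c₈) →-dec ¬? (c₈ ≟ c₅) →-dec
    all? λ c₉ → ¬? (c₄ ≟ c₉) →-dec ¬? (c₇ ≟ c₉) →-dec ¬? (c₉ ≟ c₆) →-dec
    ¬? (rich? (Vec.lookup (c₀ ∷ c₁ ∷ c₂ ∷ c₃ ∷ c₄ ∷ c₅ ∷ c₆ ∷ c₇ ∷ c₈ ∷ c₉ ∷ []))))

  ¬petersen-4-bColoring : ¬ HasBColoring petersen 4
  ¬petersen-4-bColoring (c , b) = petersen-search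
    (c 0F) (c 1F) (edge 0F 1F) (c 2F) (edge 1F 2F) (c 3F) (edge 2F 3F) (c 4F) (edge 3F 4F) (edge 4F 0F)
    (c 5F) (edge 0F 5F) (c 6F) (edge 1F 6F) (c 7F) (edge 2F 7F) (edge 5F 7F)
    (c 8F) (edge 3F 8F) (edge 6F 8F) (edge 8F 5F) (c 9F) (edge 4F 9F) (edge 7F 9F) (edge 9F 6F)
    rich
    where
    edge : ∀ u v {u∼v : True (u ∼? v)} → c u ≢ c v
    edge u v {u∼v} = proj₁ b (toWitness u∼v)

    rich : Rich (Vec.lookup (tabulate c))
    rich i =
      -- The table of `c` agrees with `c` only pointwise, so the b-colouring is carried over to it.
      let v , cv≡i , see = proj₂ (isBColoring-resp (sym ∘ lookup∘tabulate c) b) i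
      in v , cv≡i , λ j j≢i → let w , v∼w , cw≡j = see j j≢i in lose (∼⇒∈-petersen-neighbours v w v∼w) cw≡j

  -- Degree 3 allows at most four colours, and the search rules out four.
  petersen-bChromaticNumber : IsBChromaticNumber petersen 3
  petersen-bChromaticNumber =
    (petersen-3-colouring , from-yes (isBColoring? petersen-3-colouring)) ,
    λ k h → ℕ.≤-pred (ℕ.≤∧≢⇒< (Regularity.bColoring-bound {G = petersen} petersen-regular k h)
      λ { refl → ¬petersen-4-bColoring h })

theorem1 : (∀ (d : ℕ) (G : Graph) → Regular d G → ¬ Contains G C₄ →
    ∃[ φ ] IsBChromaticNumber G φ
    × ⌊ d + 3 /2⌋ ≤ φ
    × (Contains G triangle → ⌊ d + 4 /2⌋ ≤ φ))
    × Regular 3 petersen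
    × ¬ Contains petersen C₄
    × IsBChromaticNumber petersen 3
    × 3 ≡ ⌊ 3 + 3 /2⌋
    × 3 ≡ ⌊ 3 + 4 /2⌋
theorem1 =
  (λ d G regular C₄-free →
    let open Stars {G = G} regular C₄-free
        φ , φ-max , ≤φ = Regularity.bChromaticNumber≥ {G = G} regular regular-bound
    in φ , φ-max , ≤φ , λ has-triangle →
       let k , ≤k , h = contains-triangle-bound has-triangle in ℕ.≤-trans ≤k (proj₂ φ-max k h)) ,
  petersen-regular , petersen-C₄-free , petersen-bChromaticNumber , refl , refl
  where open Petersen
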